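{- For all impartial Conway's games $x,y\in\mathcal I$, $$g(x)=g(y)\iff x\approx y .$$
   Context: Hypergames: work in a universe of possibly non-wellfounded sets (set theory with the Antifoundation Axiom, and the Axiom of Choice). The class $\mathcal H$ of hypergames (also called games) is the carrier of the final coalgebra $(\mathcal H,\mathrm{id})$ of the functor $F(A)=\mathcal P(A)\times\mathcal P(A)$ on the category of classes and functional classes, where $\mathcal P$ is the powerset functor. Thus a hypergame is a pair $x=(X^L,X^R)$ of sets of hypergames; elements of $X^L$, $X^R$ are the Left and Right options of $x$. Positions of $x$ are the hypergames hereditarily reachable from $x$. Impartial Conway's games: a hypergame is impartial if at every position L and R have the same options; an impartial game is represented simply as the set $x=X$ of its options, identified with the hypergame $(X,X)$ (hereditarily). $\mathcal I$ is the class of well-founded impartial games, i.e. the carrier of the initial algebra of $\mathcal P$ (well-founded sets). Grundy function: for a set $S$ of ordinals, $\mathrm{mex}(S)$ is the least ordinal not in $S$. $g:\mathcal I\to\mathrm{Ord}$ is the Grundy-Sprague function, the unique function with $g(x)=\mathrm{mex}\{g(y)\mid y\in x\}$. Sum (on hypergames, defined coinductively): $x+y=(\{x^L+y\mid x^L\in X^L\}\cup\{x+y^L\mid y^L\in Y^L\},\ \{x^R+y\mid x^R\in X^R\}\cup\{x+y^R\mid y^R\in Y^R\})$. Plays: L (Left) and R (Right) move alternately; either may start. Player I is the one who starts, player II the other one; LI means L acting as player I, and similarly LII, RI, RII. A play on $x$ is a (possibly empty) finite or infinite sequence $x_1^{K_1}x_2^{K_2}\cdots$ with $K_i\in\{L,R\}$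 and $K_{i+1}\neq K_i$, such that, with $x_0=x$ and $x_i=(X_i^L,X_i^R)$, one has $x_{i+1}\in X_i^{K_{i+1}}$ for all $i\ge 0$. A finite play is winning for L (resp. R) if it ends with a position $y=(Y^L,Y^R)$ where R (resp. L) is next to move but $Y^R=\emptyset$ (resp. $Y^L=\emptyset$); the empty play ends at $x$ with the starting player next to move. Every infinite play is a draw. A play is non-losing for L (resp. R) if it is winning for L (resp. R) or is a draw. Strategies: for P in $\{$LI, LII, RI, RII$\}$ let $\mathrm{FPlay}^P_x$ be the set of finite plays on $x$ in which P has the prescribed role (first or second player) and is next to move (the empty play is included exactly when P is LI or RI). A strategy for P on $x$ is a partial function $f$ from $\mathrm{FPlay}^P_x$ to positions of $x$ such that $f(\pi)=x'$ implies that $\pi x'$ is a play, and $f(\pi)$ is defined whenever some $\pi x'$ is a play. The opponent of LI is RII, and of LII is RI (and conversely). A play $\pi$ is coherent with $f$ if for each proper prefix $\pi'$ of $\pi$ where P is next to move, $f(\pi')=x'$ implies $\pi'x'$ is a prefix of $\pi$. For a strategy $f$ for P and a strategy $f'$ for the opponent, $f*f'$ is the unique maximal play coherent with both. $f$ is non-losing for P if $f*f'$ is non-losing for P (i.e. for L or R accordingly) for every strategy $f'$ of the opponent. A strategy for L is a pair of strategies for LI and LII; for R, for RI and RII; for I, for LI and RI; for II, for LII and RII. Such a pair is non-losing if both components are. Equideterminacy: $x\Updownarrow y$ iff, for each player P in $\{$L, R, I, II$\}$, $x$ has a non-losing strategy for P if and only if $y$ does. Contextual equivalence: additive contexts are $C[\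 ]::=[\ ]\mid C[\ ]+z\mid z+C[\ ]$ with $z$ any hypergame; $x\approx y$ iff $C[x]\Updownarrow C[y]$ for every additive context $C[\ ]$. -}

module Defs where

open import Level using (0ℓ)
open import Axiom.ExcludedMiddle using (ExcludedMiddle)
open import Data.Empty using (⊥-elim)
open import Data.List.Base using (List; []; _∷_; _∷ʳ_; applyUpTo)
open import Data.List.Relation.Binary.Pointwise using (Pointwise)
open import Data.List.Relation.Binary.Prefix.Heterogeneous using (Prefix)
open import Data.Maybe.Base using (Maybe; just; nothing)
import Data.Maybe.Relation.Binary.Pointwise as Maybe
open import Data.Nat.Base using (ℕ)
open import Data.Product.Base using (Σ; ∃; ∃₂; _×_; _,_; proj₁; proj₂)
open import Data.Sum.Base using (_⊎_; inj₁; inj₂)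
open import Function.Base using (_∘_)
open import Function.Bundles using (_⇔_)
open import Relation.Binary.Core using (Rel; REL)
open import Relation.Binary.Structures using (IsEquivalence)
open import Relation.Binary.PropositionalEquality.Core using (_≡_; refl)
open import Relation.Nullary.Negation.Core using (¬_)
open import Relation.Nullary.Decidable.Core using (yes; no)
open import Relation.Unary using (Pred)

-- Conventions.  Types in Set play the role of sets, types in Set₁ that of
-- classes.

-- Zermelo's form of the axiom of choice: every equivalence relation on a set
-- has a system of representatives.  Type-theoretic choice does not give this,
-- because r must send equivalent elements to the same representative.

AxiomOfChoice : Set₁
AxiomOfChoice =
  (A : Set) (_~_ : Rel A 0ℓ) → IsEquivalence _~_ →
  Σ (A → A) λ r → (∀ a → r a ~ a) × (∀ {a b} → a ~ b → r a ≡ r b)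

------------------------------------------------------------------------
-- Well-founded sets

-- The initial algebra of the powerset functor, in Aczel's presentation: a set
-- is a small family of sets, and equality is the extensional one.

data WFSet : Set₁ where
  set : (A : Set) → (A → WFSet) → WFSet

Index : WFSet → Set
Index (set A f) = A

elem : (x : WFSet) → Index x → WFSet
elem (set A f) = f

infix 4 _≐_ _∈_ _⊆_

_≐_ : WFSet → WFSet → Set
set A f ≐ set B h = (∀ a → ∃ λ b → f a ≐ h b) × (∀ b → ∃ λ a → f a ≐ h b)

_∈_ : WFSet → WFSet → Set
x ∈ y = ∃ λ j → x ≐ elem y j

_⊆_ : WFSet → WFSet → Set
x ⊆ y = ∀ i → elem x i ∈ y

≐-refl : ∀ x → x ≐ x
≐-refl (set A f) = (λ a → a , ≐-refl (f a)) , (λ a → a , ≐-refl (f a))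

≐-sym : ∀ x y → x ≐ y → y ≐ x
≐-sym (set A f) (set B h) (p , q) =
  (λ b → let (a , e) = q b in a , ≐-sym (f a) (h b) e) ,
  (λ a → let (b , e) = p a in b , ≐-sym (f a) (h b) e)

≐-trans : ∀ x y z → x ≐ y → y ≐ z → x ≐ z
≐-trans (set A f) (set B h) (set C k) (p , q) (p′ , q′) =
  (λ a → let (b , e) = p a ; (c , e′) = p′ b in c , ≐-trans (f a) (h b) (k c) e e′) ,
  (λ c → let (b , e′) = q′ c ; (a , e) = q b in a , ≐-trans (f a) (h b) (k c) e e′)

elem-∈ : ∀ x i → elem x i ∈ x
elem-∈ x i = i , ≐-refl (elem x i)

∈-respˡ : ∀ x x′ y → x ≐ x′ → x ∈ y → x′ ∈ y
∈-respˡ x x′ y e (j , e′) = j , ≐-trans x′ x (elem y j) (≐-sym x x′ e) e′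

∈-respʳ : ∀ x y y′ → y ≐ y′ → x ∈ y → x ∈ y′
∈-respʳ x (set B h) (set C k) (p , q) (b , e) =
  let (c , e′) = p b in c , ≐-trans x (h b) (k c) e e′

⊆-∈ : ∀ x y z → y ⊆ z → x ∈ y → x ∈ z
⊆-∈ x y z y⊆z (j , e) = ∈-respˡ (elem y j) x z (≐-sym x (elem y j) e) (y⊆z j)

⊆-resp : ∀ x x′ y → x ≐ x′ → x ⊆ y → x′ ⊆ y
⊆-resp x x′ y e x⊆y i =
  ⊆-∈ (elem x′ i) x y x⊆y
    (∈-respʳ (elem x′ i) x′ x (≐-sym x x′ e) (elem-∈ x′ i))

∈-irrefl : ∀ x → ¬ x ∈ x
∈-irrefl x@(set A f) (a , e) =
  ∈-irrefl (f a) (∈-respʳ (f a) x (f a) e (elem-∈ x a))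

------------------------------------------------------------------------
-- Ordinals

-- Von Neumann ordinals: transitive sets of transitive sets.

Transitive : WFSet → Set
Transitive x = ∀ i → elem x i ⊆ x

IsOrdinal : WFSet → Set
IsOrdinal x = Transitive x × (∀ i → Transitive (elem x i))

record Ord : Set₁ where
  constructor ord
  field
    ∣_∣       : WFSet
    isOrdinal : IsOrdinal ∣_∣

open Ord public

infix 4 _≐ᵒ_ _<ᵒ_ _≤ᵒ_ _∉ᶠ_

_≐ᵒ_ _<ᵒ_ _≤ᵒ_ : Ord → Ord → Set
α ≐ᵒ β = ∣ α ∣ ≐ ∣ β ∣
α <ᵒ β = ∣ α ∣ ∈ ∣ β ∣
α ≤ᵒ β = α <ᵒ β ⊎ α ≐ᵒ β

_∉ᶠ_ : Ord → {A : Set} → (A → Ord) → Set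
α ∉ᶠ S = ∀ a → ¬ α ≐ᵒ S a

-- As a von Neumann ordinal, the least ordinal outside S is the initial segment
-- of the ordinals below it, that is { β ∈ S ∣ every γ < β is in S }; see mex-∉
-- and mex-least.

mex : {A : Set} → (A → Ord) → Ord
mex {A} S = ord segment (transitive , λ (a , _) → proj₁ (isOrdinal (S a)))
  where
  S′ segment : WFSet
  S′      = set A λ a → ∣ S a ∣
  segment = set (∃ λ a → ∣ S a ∣ ⊆ S′) λ (a , _) → ∣ S a ∣

  transitive : Transitive segment
  transitive (a , Sa⊆S′) i =
    let (b , e) = Sa⊆S′ i
        Sb⊆S′   = ⊆-resp (elem ∣ S a ∣ i) ∣ S b ∣ S′ e λ j →
                    ⊆-∈ (elem (elem ∣ S a ∣ i) j) ∣ S a ∣ S′ Sa⊆S′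
                      (proj₁ (isOrdinal (S a)) i j)
    in (b , Sb⊆S′) , e

mex-∉ : {A : Set} (S : A → Ord) → mex S ∉ᶠ S
mex-∉ S a e = ∈-irrefl ∣ mex S ∣ ((a , below) , e)
  where
  below : ∣ S a ∣ ⊆ set _ λ b → ∣ S b ∣
  below i = let ((b , _) , e′) = ∈-respʳ (elem ∣ S a ∣ i) ∣ S a ∣ ∣ mex S ∣
                                   (≐-sym ∣ mex S ∣ ∣ S a ∣ e) (elem-∈ ∣ S a ∣ i)
            in b , e′

transitive-resp : ∀ x y → x ≐ y → Transitive x → Transitive y
transitive-resp x y e t j k =
  let (i , e′) = ∈-respʳ (elem y j) y x (≐-sym x y e) (elem-∈ y j)
  in ∈-respʳ (elem (elem y j) k) x y e
       (⊆-resp (elem x i) (elem y j) x (≐-sym (elem y j) (elem x i) e′) (t i) k)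

ordinal-elem : ∀ x → IsOrdinal x → ∀ i → IsOrdinal (elem x i)
ordinal-elem x (t , ts) i = ts i , λ j →
  let (k , e) = t i j
  in transitive-resp (elem x k) (elem (elem x i) j)
       (≐-sym (elem (elem x i) j) (elem x k) e) (ts k)

module _ (em : ExcludedMiddle 0ℓ) where

  Comparable : WFSet → WFSet → Set
  Comparable x y = x ∈ y ⊎ x ≐ y ⊎ y ∈ x

  trichotomy : ∀ x y → IsOrdinal x → IsOrdinal y → Comparable x y
  trichotomy x@(set A f) y@(set B h) ox oy = step
    (λ a → trichotomy (f a) (set B h) (ordinal-elem x ox a) oy)
    (λ b → trichotomy (set A f) (h b) ox (ordinal-elem y oy b))
    where
    step : (∀ a → Comparable (f a) y) → (∀ b → Comparable x (h b)) → Comparable x y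
    step cx cy
      with em {∃ λ a → y ≐ f a ⊎ y ∈ f a} | em {∃ λ b → x ≐ h b ⊎ x ∈ h b}
    ... | yes (a , inj₁ e) | _ = inj₂ (inj₂ (a , e))
    ... | yes (a , inj₂ m) | _ = inj₂ (inj₂ (⊆-∈ y (f a) x (proj₁ ox a) m))
    ... | no _ | yes (b , inj₁ e) = inj₁ (b , e)
    ... | no _ | yes (b , inj₂ m) = inj₁ (⊆-∈ x (h b) y (proj₁ oy b) m)
    ... | no ¬a | no ¬b = inj₂ (inj₁ (x⊆y , y⊆x))
      where
      x⊆y : ∀ a → f a ∈ y
      x⊆y a with cx a
      ... | inj₁ m        = m
      ... | inj₂ (inj₁ e) = ⊥-elim (¬a (a , inj₁ (≐-sym (f a) y e)))
      ... | inj₂ (inj₂ m) = ⊥-elim (¬a (a , inj₂ m))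

      y⊆x : ∀ b → ∃ λ a → f a ≐ h b
      y⊆x b with cy b
      ... | inj₁ m              = ⊥-elim (¬b (b , inj₂ m))
      ... | inj₂ (inj₁ e)       = ⊥-elim (¬b (b , inj₁ e))
      ... | inj₂ (inj₂ (a , e)) = a , ≐-sym (h b) (f a) e

  mex-least : {A : Set} (S : A → Ord) (β : Ord) → β ∉ᶠ S → mex S ≤ᵒ β
  mex-least S β β∉S
    with trichotomy ∣ mex S ∣ ∣ β ∣ (isOrdinal (mex S)) (isOrdinal β)
  ... | inj₁ m                    = inj₁ m
  ... | inj₂ (inj₁ e)             = inj₂ e
  ... | inj₂ (inj₂ ((a , _) , e)) = ⊥-elim (β∉S a e)

------------------------------------------------------------------------
-- Hypergames

data Player : Set where
  L R : Player

opp : Player → Player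
opp L = R
opp R = L

-- By the Antifoundation Axiom, the elements of the final coalgebra of
-- X ↦ 𝒫 X × 𝒫 X are exactly the points of small coalgebras of this functor,
-- identified up to bisimilarity.  A hypergame is therefore such a coalgebra
-- (Opts L and Opts R being its two components) together with a point, and _∼_
-- is equality of hypergames.

record Hypergame : Set₁ where
  field
    Node : Set
    Opts : Player → Node → Pred Node 0ℓ
    root : Node

open Hypergame public

infixl 7 _↾_

_↾_ : (x : Hypergame) → Node x → Hypergame
x ↾ n = record { Node = Node x ; Opts = Opts x ; root = n }

record IsBisimulation (x y : Hypergame) (_~_ : REL (Node x) (Node y) 0ℓ) : Set where
  field
    forth : ∀ {m n} → m ~ n → ∀ K {m′} → Opts x K m m′ →
            ∃ λ n′ → Opts y K n n′ × m′ ~ n′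
    back  : ∀ {m n} → m ~ n → ∀ K {n′} → Opts y K n n′ →
            ∃ λ m′ → Opts x K m m′ × m′ ~ n′

infix 4 _∼_ _∈[_]_

_∼_ : Hypergame → Hypergame → Set₁
x ∼ y = ∃ λ (_~_ : REL (Node x) (Node y) 0ℓ) →
        IsBisimulation x y _~_ × (root x ~ root y)

_∈[_]_ : Hypergame → Player → Hypergame → Set₁
y ∈[ K ] x = ∃ λ n → Opts x K (root x) n × y ∼ x ↾ n

-- Judgementally (x + y) ↾ (m , n) = (x ↾ m) + (y ↾ n), so that the K-options of
-- x + y are the x′ + y and x + y′ for x′ and y′ K-options of x and y.

infixl 6 _+_

_+_ : Hypergame → Hypergame → Hypergame
x + y = record
  { Node = Node x × Node y
  ; Opts = λ K (m , n) (m′ , n′) →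
      (Opts x K m m′ × n ≡ n′) ⊎ (m ≡ m′ × Opts y K n n′)
  ; root = root x , root y
  }

------------------------------------------------------------------------
-- Impartial games

𝓘 : Set₁
𝓘 = WFSet

g : 𝓘 → Ord
g (set A f) = mex λ a → g (f a)

-- both h is the hypergame (X , X) with X = { h a ∣ a ∈ A }; its root is nothing.

module _ {A : Set} (h : A → Hypergame) where

  data BothOpts (K : Player) : Rel (Maybe (∃ λ a → Node (h a))) 0ℓ where
    enter  : ∀ a → BothOpts K nothing (just (a , root (h a)))
    inside : ∀ {a m n} → Opts (h a) K m n → BothOpts K (just (a , m)) (just (a , n))

  both : Hypergame
  both = record
    { Node = Maybe (∃ λ a → Node (h a))
    ; Opts = BothOpts
    ; root = nothing
    }

⌜_⌝ : 𝓘 → Hypergame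
⌜ set A f ⌝ = both λ a → ⌜ f a ⌝

------------------------------------------------------------------------
-- Plays

-- The tags of a play are determined by the player who starts (s below) and by
-- alternation, so a play is given by s and a sequence of hypergames.

turn : Player → List Hypergame → Player
turn s []      = s
turn s (_ ∷ π) = turn (opp s) π

end : Hypergame → List Hypergame → Hypergame
end x []      = x
end x (y ∷ π) = end y π

data Legal : Player → Hypergame → List Hypergame → Set₁ where
  []  : ∀ {s x} → Legal s x []
  _∷_ : ∀ {s x y π} → y ∈[ s ] x → Legal (opp s) y π → Legal s x (y ∷ π)

data Seq : Set₁ where
  fin : List Hypergame → Seq
  inf : (ℕ → Hypergame) → Seq

data IsPlay (s : Player) (x : Hypergame) : Seq → Set₁ where
  fin : ∀ {π} → Legal s x π → IsPlay s x (fin π)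
  inf : ∀ {σ} → (∀ n → Legal s x (applyUpTo σ n)) → IsPlay s x (inf σ)

infix 4 _⊑_ _≼_ _⊏_

_⊑_ : List Hypergame → Seq → Set₁
π ⊑ fin ρ = Prefix _∼_ π ρ
π ⊑ inf σ = ∃ λ n → Pointwise _∼_ π (applyUpTo σ n)

-- The prefix order extended to sequences that may be infinite.

_≼_ : Seq → Seq → Set₁
ρ ≼ ρ′ = ∀ π → π ⊑ ρ → π ⊑ ρ′

_⊏_ : List Hypergame → Seq → Set₁
π ⊏ ρ = π ⊑ ρ × ¬ (ρ ≼ fin π)

Winning : Player → (s : Player) → Hypergame → List Hypergame → Set₁
Winning K s x π = turn s π ≡ opp K × (∀ y → ¬ y ∈[ opp K ] end x π)

-- Every infinite play is a draw.

data NonLosingPlay (K s : Player) (x : Hypergame) : Seq → Set₁ where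
  win  : ∀ {π} → Winning K s x π → NonLosingPlay K s x (fin π)
  draw : ∀ {σ} → NonLosingPlay K s x (inf σ)

------------------------------------------------------------------------
-- Strategies

data Order : Set where
  I II : Order

-- LI, LII, RI and RII.

Seat : Set
Seat = Player × Order

side : Seat → Player
side (K , _) = K

starter : Seat → Player
starter (K , I)  = K
starter (K , II) = opp K

opponent : Seat → Seat
opponent (K , I)  = opp K , II
opponent (K , II) = opp K , I

FPlay : Seat → Hypergame → List Hypergame → Set₁
FPlay P x π = Legal (starter P) x π × turn (starter P) π ≡ side P

-- cong: a strategy is a function of the play, and plays are equal when they are
-- pointwise bisimilar.

record Strategy (P : Seat) (x : Hypergame) : Set₁ where
  field
    move  : ∀ π → FPlay P x π → Maybe Hypergame
    cong  : ∀ {π π′} (p : FPlay P x π) (p′ : FPlay P x π′) →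
            Pointwise _∼_ π π′ → Maybe.Pointwise _∼_ (move π p) (move π′ p′)
    legal : ∀ {π} (p : FPlay P x π) {y} → move π p ≡ just y →
            Legal (starter P) x (π ∷ʳ y)
    total : ∀ {π} (p : FPlay P x π) {y} → Legal (starter P) x (π ∷ʳ y) →
            ∃ λ y′ → move π p ≡ just y′

open Strategy public

Coherent : ∀ {P x} → Strategy P x → Seq → Set₁
Coherent {P} {x} f ρ =
  ∀ π (p : FPlay P x π) → π ⊏ ρ → ∀ y → move f π p ≡ just y → (π ∷ʳ y) ⊑ ρ

-- ρ is f * f′.

record IsProduct {P x} (f : Strategy P x) (f′ : Strategy (opponent P) x)
                 (ρ : Seq) : Set₁ where
  field
    isPlay    : IsPlay (starter P) x ρ
    coherent  : Coherent f ρ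
    coherent′ : Coherent f′ ρ
    maximal   : ∀ ρ′ → IsPlay (starter P) x ρ′ → Coherent f ρ′ → Coherent f′ ρ′ →
                ρ ≼ ρ′ → ρ′ ≼ ρ

NonLosing : ∀ {P x} → Strategy P x → Set₁
NonLosing {P} {x} f = ∀ (f′ : Strategy (opponent P) x) ρ → IsProduct f f′ ρ →
                      NonLosingPlay (side P) (starter P) x ρ

data Agent : Set where
  player : Player → Agent
  order  : Order → Agent

seats : Agent → Seat × Seat
seats (player K) = (K , I) , (K , II)
seats (order o)  = (L , o) , (R , o)

HasNonLosing : Agent → Hypergame → Set₁
HasNonLosing A x =
  ∃₂ λ (f₁ : Strategy (proj₁ (seats A)) x) (f₂ : Strategy (proj₂ (seats A)) x) →
  NonLosing f₁ × NonLosing f₂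

------------------------------------------------------------------------
-- Equideterminacy and contextual equivalence

infix 4 _⇕_ _≈_

_⇕_ : Hypergame → Hypergame → Set₁
x ⇕ y = ∀ A → HasNonLosing A x ⇔ HasNonLosing A y

data Context : Set₁ where
  hole : Context
  _+ʳ_ : Context → Hypergame → Context
  _+ˡ_ : Hypergame → Context → Context

_[_] : Context → Hypergame → Hypergame
hole     [ x ] = x
(C +ʳ z) [ x ] = C [ x ] + z
(z +ˡ C) [ x ] = z + C [ x ]

_≈_ : Hypergame → Hypergame → Set₁
x ≈ y = ∀ C → C [ x ] ⇕ C [ y ]

module Submission where

-- Call a seat (LI, LII, RI or RII) doomed on x if its opponent can force a win
-- there; Doomed is an inductive predicate, since won plays are finite.  Games
-- are determined in the sense that a seat has a non-losing strategy exactly when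
-- it is not doomed (NonLosing⇔¬Doomed).  A seat that is not doomed
-- only has to move to positions where it is still not doomed.  Since a strategy
-- must respect bisimilarity of plays, its choices are made at a chosen
-- representative of the current position.  Conversely, given a strategy f of a
-- doomed seat, recursion on the derivation of doom yields one finite play,
-- coherent with f, that f loses.  The opponent's strategy need only follow that
-- single play, so no ranking of the doomed positions is needed.
--
-- Every context is, up to bisimilarity, addition of a fixed hypergame z (plug-∼).
-- If g x = g y, doom passes from x + z to y + z (Doomed-≋): a move in the
-- impartial component, which changes its value, is either matched by a move
-- to that value in the other game, or undone by a move back to the common value
-- g x = g y.  This is a lexicographic induction on the derivation of doom and
-- on y.  Hence equal Grundy values give contextual equivalence.
--
-- Conversely, use the context [ ] + y.  Player II has non-losing strategies on
-- y + y: after a move to a sum of unequal values, equality of the values can be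
-- restored (≋⇒¬Doomed-II).  By contextual equivalence player II also has them on
-- x + y; but if g x and g y differed, the starting player could make the values
-- equal and then win by the same restoring replies, for x and y are well-founded
-- (≋̸⇒Doomed-II).

open import Level using (0ℓ; suc; Lift; lift; lower)
open import Axiom.ExcludedMiddle using (ExcludedMiddle)
open import Data.Empty using (⊥; ⊥-elim)
open import Data.List.Base using (List; []; _∷_; _∷ʳ_; length; applyUpTo)
open import Data.List.Relation.Binary.Pointwise using (Pointwise; []; _∷_)
import Data.List.Relation.Binary.Pointwise as Pointwise
open import Data.List.Relation.Binary.Prefix.Heterogeneous using (Prefix; []; _∷_; _++ᵖ_)
import Data.List.Relation.Binary.Prefix.Heterogeneous.Properties as Prefix
open import Data.List.Reverse using (Reverse; []; _∶_∶ʳ_; reverseView)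
open import Data.Maybe.Base using (Maybe; just; nothing)
import Data.Maybe.Relation.Binary.Pointwise as Maybe
open import Data.Nat.Base as ℕ using (ℕ)
open import Data.Product.Base using (∃; _×_; _,_; proj₁; proj₂; map₂; swap)
open import Data.Sum.Base using (_⊎_; inj₁; inj₂; [_,_]′)
import Data.Sum.Base as Sum
open import Data.Unit.Base using (⊤; tt)
open import Function.Base using (_∘_)
open import Function.Bundles using (_⇔_; mk⇔; Equivalence)
open import Relation.Binary.Core using (Rel; REL)
open import Relation.Binary.PropositionalEquality.Core as ≡ using (_≡_; refl; subst)
open import Relation.Nullary.Decidable
  using (True; toWitness; fromWitness; yes; no; map′; decidable-stable)
open import Relation.Nullary.Negation.Core using (¬_)
open import Defs

private
  variable
    K s : Player
    P   : Seat
    v w x x′ y y′ z : Hypergame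
    π π′ ρ : List Hypergame

------------------------------------------------------------------------
-- Bisimilarity

∼-refl : x ∼ x
∼-refl = _≡_ , record
  { forth = λ { refl K o → _ , o , refl }
  ; back  = λ { refl K o → _ , o , refl }
  } , refl

∼-sym : x ∼ y → y ∼ x
∼-sym (_~_ , b , r) = (λ n m → m ~ n) , record
  { forth = λ r K o → let (m , o′ , r′) = IsBisimulation.back b r K o in m , o′ , r′
  ; back  = λ r K o → let (n , o′ , r′) = IsBisimulation.forth b r K o in n , o′ , r′
  } , r

∼-trans : x ∼ y → y ∼ z → x ∼ z
∼-trans {x} {y} {z} (_~_ , b , r) (_≈′_ , c , s) =
  (λ m k → ∃ λ n → m ~ n × n ≈′ k) , record
  { forth = λ (n , r , s) K o →
      let (n′ , o′ , r′) = IsBisimulation.forth b r K o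
          (k′ , o″ , s′) = IsBisimulation.forth c s K o′
      in k′ , o″ , n′ , r′ , s′
  ; back = λ (n , r , s) K o →
      let (n′ , o′ , s′) = IsBisimulation.back c s K o
          (m′ , o″ , r′) = IsBisimulation.back b r K o′
      in m′ , o″ , n′ , r′ , s′
  } , _ , r , s

-- A bisimulation does not mention the roots, so it relates any of its pairs.

∼-shift : ∀ {_~_ : REL (Node x) (Node y) 0ℓ} {m n} →
          IsBisimulation x y _~_ → m ~ n → x ↾ m ∼ y ↾ n
∼-shift b r = _ , record { IsBisimulation b } , r

∈-resp-∼ : x ∼ x′ → y ∼ y′ → y ∈[ K ] x → y′ ∈[ K ] x′
∈-resp-∼ {K = K} (_ , b , r) e (n , o , e′) =
  let (n′ , o′ , r′) = IsBisimulation.forth b r K o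
  in n′ , o′ , ∼-trans (∼-sym e) (∼-trans e′ (∼-shift b r′))

------------------------------------------------------------------------
-- Sums

+-cong : x ∼ x′ → y ∼ y′ → x + y ∼ x′ + y′
+-cong (_~_ , b , r) (_≈′_ , c , s) =
  (λ (m , n) (m′ , n′) → m ~ m′ × n ≈′ n′) , record
  { forth = λ where
      (r , s) K (inj₁ (o , refl)) →
        let (_ , o′ , r′) = IsBisimulation.forth b r K o in _ , inj₁ (o′ , refl) , r′ , s
      (r , s) K (inj₂ (refl , o)) →
        let (_ , o′ , s′) = IsBisimulation.forth c s K o in _ , inj₂ (refl , o′) , r , s′
  ; back = λ where
      (r , s) K (inj₁ (o , refl)) →
        let (_ , o′ , r′) = IsBisimulation.back b r K o in _ , inj₁ (o′ , refl) , r′ , s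
      (r , s) K (inj₂ (refl , o)) →
        let (_ , o′ , s′) = IsBisimulation.back c s K o in _ , inj₂ (refl , o′) , r , s′
  } , r , s

+-comm : ∀ x y → x + y ∼ y + x
+-comm x y = (λ p q → swap p ≡ q) , record
  { forth = λ where
      refl K (inj₁ (o , refl)) → _ , inj₂ (refl , o) , refl
      refl K (inj₂ (refl , o)) → _ , inj₁ (o , refl) , refl
  ; back = λ where
      refl K (inj₁ (o , refl)) → _ , inj₂ (refl , o) , refl
      refl K (inj₂ (refl , o)) → _ , inj₁ (o , refl) , refl
  } , refl

+-assoc : ∀ x y z → (x + y) + z ∼ x + (y + z)
+-assoc x y z = (λ ((l , m) , n) q → (l , m , n) ≡ q) , record
  { forth = λ where
      refl K (inj₁ (inj₁ (o , refl) , refl)) → _ , inj₁ (o , refl) , refl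
      refl K (inj₁ (inj₂ (refl , o) , refl)) → _ , inj₂ (refl , inj₁ (o , refl)) , refl
      refl K (inj₂ (refl , o))               → _ , inj₂ (refl , inj₂ (refl , o)) , refl
  ; back = λ where
      refl K (inj₁ (o , refl))               → _ , inj₁ (inj₁ (o , refl) , refl) , refl
      refl K (inj₂ (refl , inj₁ (o , refl))) → _ , inj₁ (inj₂ (refl , o) , refl) , refl
      refl K (inj₂ (refl , inj₂ (refl , o))) → _ , inj₂ (refl , o) , refl
  } , refl

-- The game without options.

𝟘 : Hypergame
𝟘 = record { Node = ⊤ ; Opts = λ _ _ _ → ⊥ ; root = tt }

+-identityʳ : ∀ x → x + 𝟘 ∼ x
+-identityʳ x = (λ (m , _) n → m ≡ n) , record
  { forth = λ { refl K (inj₁ (o , _)) → _ , o , refl }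
  ; back  = λ { refl K o → _ , inj₁ (o , refl) , refl }
  } , refl

+-optionˡ : ∀ y → x′ ∈[ K ] x → x′ + y ∈[ K ] x + y
+-optionˡ y (n , o , e) = (n , root y) , inj₁ (o , refl) , +-cong e ∼-refl

+-optionʳ : ∀ x → y′ ∈[ K ] y → x + y′ ∈[ K ] x + y
+-optionʳ x (n , o , e) = (root x , n) , inj₂ (refl , o) , +-cong ∼-refl e

+-option⁻ : w ∈[ K ] x + y →
            (∃ λ x′ → x′ ∈[ K ] x × w ∼ x′ + y) ⊎ (∃ λ y′ → y′ ∈[ K ] y × w ∼ x + y′)
+-option⁻ {x = x} {y} ((m , n) , inj₁ (o , refl) , e) = inj₁ (x ↾ m , (m , o , ∼-refl) , e)
+-option⁻ {x = x} {y} ((m , n) , inj₂ (refl , o) , e) = inj₂ (y ↾ n , (n , o , ∼-refl) , e)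

-- The sum of the hypergames that a context adds to its argument.

remainder : Context → Hypergame
remainder hole     = 𝟘
remainder (C +ʳ z) = remainder C + z
remainder (z +ˡ C) = remainder C + z

plug-∼ : ∀ C x → C [ x ] ∼ x + remainder C
plug-∼ hole     x = ∼-sym (+-identityʳ x)
plug-∼ (C +ʳ z) x = ∼-trans (+-cong (plug-∼ C x) ∼-refl) (+-assoc x (remainder C) z)
plug-∼ (z +ˡ C) x = ∼-trans (+-comm z (C [ x ]))
  (∼-trans (+-cong (plug-∼ C x) ∼-refl) (+-assoc x (remainder C) z))

------------------------------------------------------------------------
-- Impartial games and the Grundy function

-- A position of both f inside the option f a behaves as it does in f a.

⌜⌝-node : ∀ {A : Set} (f : A → Hypergame) a n → both f ↾ just (a , n) ∼ f a ↾ n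
⌜⌝-node f a n = (λ p n → p ≡ just (a , n)) , record
  { forth = λ { refl K (inside o) → _ , o , refl }
  ; back  = λ { refl K o → _ , inside o , refl }
  } , refl

⌜⌝-option : ∀ x a → ⌜ elem x a ⌝ ∈[ K ] ⌜ x ⌝
⌜⌝-option (set A f) a = _ , enter a , ∼-sym (⌜⌝-node (⌜_⌝ ∘ f) a (root ⌜ f a ⌝))

⌜⌝-option⁻ : ∀ x → w ∈[ K ] ⌜ x ⌝ → ∃ λ a → w ∼ ⌜ elem x a ⌝
⌜⌝-option⁻ (set A f) (_ , enter a , e) = a , ∼-trans e (⌜⌝-node (⌜_⌝ ∘ f) a (root ⌜ f a ⌝))

⌜⌝+-option : ∀ x a z → ⌜ elem x a ⌝ + z ∈[ K ] ⌜ x ⌝ + z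
⌜⌝+-option x a z = +-optionˡ z (⌜⌝-option x a)

⌜⌝+-option⁻ : ∀ x → w ∈[ K ] ⌜ x ⌝ + z →
  (∃ λ a → w ∼ ⌜ elem x a ⌝ + z) ⊎ (∃ λ z′ → z′ ∈[ K ] z × w ∼ ⌜ x ⌝ + z′)
⌜⌝+-option⁻ x o with +-option⁻ o
... | inj₁ (_ , o′ , e) = let (a , e′) = ⌜⌝-option⁻ x o′
                          in inj₁ (a , ∼-trans e (+-cong e′ ∼-refl))
... | inj₂ r            = inj₂ r

-- Equality of Grundy values.

infix 4 _≋_

_≋_ : 𝓘 → 𝓘 → Set
x ≋ y = g x ≐ᵒ g y

≋-sym : ∀ x y → x ≋ y → y ≋ x
≋-sym x y = ≐-sym (∣ g x ∣) (∣ g y ∣)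

≋-trans : ∀ x y z → x ≋ y → y ≋ z → x ≋ z
≋-trans x y z = ≐-trans (∣ g x ∣) (∣ g y ∣) (∣ g z ∣)

elem-≋̸ : ∀ x a → ¬ elem x a ≋ x
elem-≋̸ x@(set A f) a e = mex-∉ (g ∘ f) a (≋-sym (f a) x e)

elem-≋̸ˡ : ∀ x y a → x ≋ y → ¬ elem x a ≋ y
elem-≋̸ˡ x y a e e′ = elem-≋̸ x a (≋-trans (elem x a) y x e′ (≋-sym x y e))

elem-≋̸ʳ : ∀ x y b → x ≋ y → ¬ x ≋ elem y b
elem-≋̸ʳ x y b e e′ = elem-≋̸ˡ y x b (≋-sym x y e) (≋-sym x (elem y b) e′)

-- By definition of mex, every ordinal below g x is the value of an option of x.

∈-g : ∀ {γ} x → γ ∈ ∣ g x ∣ → ∃ λ a → γ ≐ ∣ g (elem x a) ∣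
∈-g (set A f) ((a , _) , e) = a , e

------------------------------------------------------------------------
-- Forced losses

-- Doomed P x: in the role P on x, the opponent can force a win.  The order in the
-- seat tells who moves: (K , I) is doomed if every move of K leaves it doomed as
-- second player; (K , II) if some move of the opponent leaves it doomed as first
-- player.  The definition is inductive because the opponent has to win after
-- finitely many moves.

data Doomed : Seat → Hypergame → Set₁ where
  stuck  : (∀ y → y ∈[ K ] x → Doomed (K , II) y) → Doomed (K , I) x
  beaten : ∀ y → y ∈[ opp K ] x → Doomed (K , I) y → Doomed (K , II) x

Doomed-resp-∼ : x ∼ x′ → Doomed P x → Doomed P x′
Doomed-resp-∼ e (stuck h)      = stuck λ y o → h y (∈-resp-∼ (∼-sym e) ∼-refl o)
Doomed-resp-∼ e (beaten y o d) = beaten y (∈-resp-∼ e ∼-refl o) d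

lower-em : ExcludedMiddle (suc 0ℓ) → ExcludedMiddle 0ℓ
lower-em em {A} = map′ lower lift (em {Lift (suc 0ℓ) A})

module _ (em : ExcludedMiddle (suc 0ℓ)) where

  -- If the values differ, an option of the game of greater value has the lesser one.

  compare : ∀ x y → x ≋ y ⊎ (∃ λ a → elem x a ≋ y) ⊎ (∃ λ b → x ≋ elem y b)
  compare x y with trichotomy (lower-em em) (∣ g x ∣) (∣ g y ∣) (isOrdinal (g x)) (isOrdinal (g y))
  ... | inj₁ m        = inj₂ (inj₂ (∈-g y m))
  ... | inj₂ (inj₁ e) = inj₁ e
  ... | inj₂ (inj₂ m) = let (a , e) = ∈-g x m
                        in inj₂ (inj₁ (a , ≋-sym y (elem x a) e))

  -- Doom depends on an impartial summand only through its Grundy value.  The game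
  -- w stands for a sum up to bisimilarity so that the recursion can stay
  -- structural in the derivation of Doomed P w.  In Doomed-≋-option, K has moved
  -- from y + z to v.  Doomed-≋-revert serves the case where K has moved to a game,
  -- there called y, that has an option of the original value: the opponent of K
  -- moves to it, the derivation stays the same and the game has become smaller.

  Doomed-≋ : ∀ x y → x ≋ y → w ∼ ⌜ x ⌝ + z → Doomed P w → Doomed P (⌜ y ⌝ + z)
  Doomed-≋-option : ∀ x y → x ≋ y → w ∼ ⌜ x ⌝ + z → Doomed (K , I) w →
    (∃ λ b → v ∼ ⌜ elem y b ⌝ + z) ⊎ (∃ λ z′ → z′ ∈[ K ] z × v ∼ ⌜ y ⌝ + z′) →
    Doomed (K , II) v
  Doomed-≋-revert : ∀ x y b → x ≋ elem y b → w ∼ ⌜ x ⌝ + z → Doomed (K , I) w →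
    Doomed (K , II) (⌜ y ⌝ + z)

  Doomed-≋ x y q e d@(stuck _) =
    stuck λ v o → Doomed-≋-option x y q e d (⌜⌝+-option⁻ y o)
  Doomed-≋ {z = z} x y q e (beaten v o d@(stuck h)) =
    [ (λ (a , e′) →
        -- The winning move leads to an option of x.  If it raised the value, then
        -- the derivation also covers the move of K back to the value of y.
        [ (λ r → ⊥-elim (elem-≋̸ˡ x y a q r))
        , [ (λ (c , r) → Doomed-≋ (elem (elem x a) c) y r ∼-refl
              (h _ (∈-resp-∼ (∼-sym e′) ∼-refl (⌜⌝+-option (elem x a) c z))))
          , (λ (b , r) →
              beaten _ (⌜⌝+-option y b z) (Doomed-≋ (elem x a) (elem y b) r e′ d))
          ]′
        ]′ (compare (elem x a) y))
    , (λ (z′ , o′ , e′) → beaten _ (+-optionʳ ⌜ y ⌝ o′) (Doomed-≋ x y q e′ d))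
    ]′ (⌜⌝+-option⁻ x (∈-resp-∼ e ∼-refl o))

  Doomed-≋-option x y q e (stuck h) (inj₂ (z′ , o , e′)) = Doomed-resp-∼ (∼-sym e′)
    (Doomed-≋ x y q ∼-refl (h _ (∈-resp-∼ (∼-sym e) ∼-refl (+-optionʳ ⌜ x ⌝ o))))
  Doomed-≋-option {z = z} x y@(set B k) q e d@(stuck h) (inj₁ (b , e′)) =
    Doomed-resp-∼ (∼-sym e′)
      ([ (λ r → ⊥-elim (elem-≋̸ʳ x y b q r))
       , [ (λ (a , r) → Doomed-≋ (elem x a) (k b) r ∼-refl
             (h _ (∈-resp-∼ (∼-sym e) ∼-refl (⌜⌝+-option x a z))))
         , (λ (c , r) → Doomed-≋-revert x (k b) c r e d)
         ]′
       ]′ (compare x (k b)))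

  Doomed-≋-revert {z = z} x y@(set B k) b r e d =
    beaten _ (⌜⌝+-option y b z) (Doomed-≋ x (k b) r e d)

  -- On x + y, whoever starts loses if the values are equal and wins if they differ.

  ≋⇒Doomed-I : ∀ x y → x ≋ y → Doomed (K , I) (⌜ x ⌝ + ⌜ y ⌝)
  ≋-option⇒Doomed-II : ∀ x y → x ≋ y →
    (∃ λ a → v ∼ ⌜ elem x a ⌝ + ⌜ y ⌝) ⊎ (∃ λ z → z ∈[ K ] ⌜ y ⌝ × v ∼ ⌜ x ⌝ + z) →
    Doomed (K , II) v
  ≋̸⇒Doomed-II : ∀ x y → ¬ x ≋ y → Doomed (K , II) (⌜ x ⌝ + ⌜ y ⌝)

  ≋⇒Doomed-I x y q = stuck λ v o → ≋-option⇒Doomed-II x y q (⌜⌝+-option⁻ x o)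

  ≋-option⇒Doomed-II x@(set A f) y q (inj₁ (a , e)) =
    Doomed-resp-∼ (∼-sym e) (≋̸⇒Doomed-II (f a) y (elem-≋̸ˡ x y a q))
  ≋-option⇒Doomed-II x y@(set B k) q (inj₂ (z , o , e)) with (b , e′) ← ⌜⌝-option⁻ y o =
    Doomed-resp-∼ (∼-sym (∼-trans e (+-cong ∼-refl e′)))
      (≋̸⇒Doomed-II x (k b) (elem-≋̸ʳ x y b q))

  ≋̸⇒Doomed-II x@(set A f) y@(set B k) q =
    [ ⊥-elim ∘ q
    , [ (λ (a , r) → beaten _ (⌜⌝+-option x a ⌜ y ⌝) (≋⇒Doomed-I (f a) y r))
      , (λ (b , r) →
          beaten _ (+-optionʳ ⌜ x ⌝ (⌜⌝-option y b)) (≋⇒Doomed-I x (k b) r))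
      ]′
    ]′ (compare x y)

  -- The winner of x + y is not doomed as well.

  ≋⇒¬Doomed-II : ∀ {w} x y → x ≋ y → w ∼ ⌜ x ⌝ + ⌜ y ⌝ → ¬ Doomed (K , II) w
  ≋̸⇒¬Doomed-I : ∀ {w} x y → ¬ x ≋ y → w ∼ ⌜ x ⌝ + ⌜ y ⌝ → ¬ Doomed (K , I) w

  ≋⇒¬Doomed-II x y q e (beaten v o d) with ⌜⌝+-option⁻ x (∈-resp-∼ e ∼-refl o)
  ... | inj₁ (a , e′) = ≋̸⇒¬Doomed-I (elem x a) y (elem-≋̸ˡ x y a q) e′ d
  ... | inj₂ (z , o′ , e′) with (b , e″) ← ⌜⌝-option⁻ y o′ =
    ≋̸⇒¬Doomed-I x (elem y b) (elem-≋̸ʳ x y b q) (∼-trans e′ (+-cong ∼-refl e″)) d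

  ≋̸⇒¬Doomed-I x y q e (stuck h) with compare x y
  ... | inj₁ r              = q r
  ... | inj₂ (inj₁ (a , r)) = ≋⇒¬Doomed-II (elem x a) y r ∼-refl
    (h _ (∈-resp-∼ (∼-sym e) ∼-refl (⌜⌝+-option x a ⌜ y ⌝)))
  ... | inj₂ (inj₂ (b , r)) = ≋⇒¬Doomed-II x (elem y b) r ∼-refl
    (h _ (∈-resp-∼ (∼-sym e) ∼-refl (+-optionʳ ⌜ x ⌝ (⌜⌝-option y b))))

------------------------------------------------------------------------
-- Plays

Pointwise-∼-refl : Pointwise _∼_ π π
Pointwise-∼-refl = Pointwise.refl ∼-refl

Prefix-∼-refl : Prefix _∼_ π π
Prefix-∼-refl = Prefix.fromPointwise Pointwise-∼-refl

opp-involutive : ∀ K → opp (opp K) ≡ K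
opp-involutive L = refl
opp-involutive R = refl

≢-opp : ∀ K → ¬ K ≡ opp K
≢-opp L ()
≢-opp R ()

same-or-opp : ∀ K s → s ≡ K ⊎ s ≡ opp K
same-or-opp L L = inj₁ refl
same-or-opp L R = inj₂ refl
same-or-opp R L = inj₂ refl
same-or-opp R R = inj₁ refl

starter-opponent : ∀ P → starter (opponent P) ≡ starter P
starter-opponent (K , I)  = opp-involutive K
starter-opponent (K , II) = refl

side-opponent : ∀ P → side (opponent P) ≡ opp (side P)
side-opponent (K , I)  = refl
side-opponent (K , II) = refl

-- The order of a player, seen from the position after one more move.

flip : Order → Order
flip I  = II
flip II = I

-- The order of a player, seen from the position after a play on which it had
-- order o at the start.

after : Order → List Hypergame → Order
after o []      = o
after o (_ ∷ π) = after (flip o) π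

starter-flip : ∀ K o → starter (K , flip o) ≡ opp (starter (K , o))
starter-flip K I  = refl
starter-flip K II = ≡.sym (opp-involutive K)

turn-after : ∀ K o π → turn (starter (K , o)) π ≡ starter (K , after o π)
turn-after K o []      = refl
turn-after K o (_ ∷ π) =
  ≡.trans (≡.cong (λ s → turn s π) (≡.sym (starter-flip K o))) (turn-after K (flip o) π)

after-∷ʳ : ∀ o π y → after o (π ∷ʳ y) ≡ flip (after o π)
after-∷ʳ o []      y = refl
after-∷ʳ o (_ ∷ π) y = after-∷ʳ (flip o) π y

end-∷ʳ : ∀ x π y → end x (π ∷ʳ y) ≡ y
end-∷ʳ x []      y = refl
end-∷ʳ x (z ∷ π) y = end-∷ʳ z π y

turn-resp : Pointwise _∼_ π π′ → turn s π ≡ turn s π′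
turn-resp []       = refl
turn-resp (_ ∷ es) = turn-resp es

end-resp-∼ : x ∼ x′ → Pointwise _∼_ π π′ → end x π ∼ end x′ π′
end-resp-∼ e []       = e
end-resp-∼ _ (e ∷ es) = end-resp-∼ e es

Legal-∷ʳ⁺ : Legal s x π → y ∈[ turn s π ] end x π → Legal s x (π ∷ʳ y)
Legal-∷ʳ⁺ []      o = o ∷ []
Legal-∷ʳ⁺ (m ∷ l) o = m ∷ Legal-∷ʳ⁺ l o

Legal-∷ʳ⁻ : ∀ π → Legal s x (π ∷ʳ y) → Legal s x π × y ∈[ turn s π ] end x π
Legal-∷ʳ⁻ []      (o ∷ []) = [] , o
Legal-∷ʳ⁻ (_ ∷ π) (m ∷ l)  = let (l′ , o) = Legal-∷ʳ⁻ π l in m ∷ l′ , o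

¬Prefix-∷ʳ : ∀ π → ¬ Prefix _∼_ (π ∷ʳ y) π
¬Prefix-∷ʳ (_ ∷ π) (_ ∷ p) = ¬Prefix-∷ʳ π p

Prefix-∷ʳ⇒Prefix : ∀ π → Prefix _∼_ (π ∷ʳ y) ρ → Prefix _∼_ π ρ
Prefix-∷ʳ⇒Prefix []      _       = []
Prefix-∷ʳ⇒Prefix (_ ∷ π) (e ∷ p) = e ∷ Prefix-∷ʳ⇒Prefix π p

-- A prefix of a sequence is all of it or can be prolonged within it.

Prefix-cases : Prefix _∼_ π ρ → Pointwise _∼_ π ρ ⊎ (∃ λ y → Prefix _∼_ (π ∷ʳ y) ρ)
Prefix-cases {ρ = []}    []      = inj₁ []
Prefix-cases {ρ = z ∷ _} []      = inj₂ (z , ∼-refl ∷ [])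
Prefix-cases             (e ∷ p) = Sum.map (e ∷_) (map₂ (e ∷_)) (Prefix-cases p)

Prefix-∷ʳ-cases : ∀ π ρ → Prefix _∼_ (π ∷ʳ y) (ρ ∷ʳ z) →
                  Prefix _∼_ (π ∷ʳ y) ρ ⊎ (Pointwise _∼_ π ρ × y ∼ z)
Prefix-∷ʳ-cases []          []      (e ∷ [])    = inj₂ ([] , e)
Prefix-∷ʳ-cases []          (_ ∷ _) (e ∷ [])    = inj₁ (e ∷ [])
Prefix-∷ʳ-cases (_ ∷ [])    []      (_ ∷ ())
Prefix-∷ʳ-cases (_ ∷ _ ∷ _) []      (_ ∷ ())
Prefix-∷ʳ-cases (_ ∷ π)     (_ ∷ ρ) (e ∷ p)     =
  Sum.map (e ∷_) (λ (es , e′) → e ∷ es , e′) (Prefix-∷ʳ-cases π ρ p)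

-- The hypergame at index k of ρ is y, up to bisimilarity; false beyond the end.

At : List Hypergame → ℕ → Hypergame → Set₁
At []      _         y = Lift (suc 0ℓ) ⊥
At (z ∷ _) ℕ.zero    y = y ∼ z
At (_ ∷ ρ) (ℕ.suc k) y = At ρ k y

At-unique : ∀ ρ k → At ρ k y → At ρ k z → y ∼ z
At-unique (_ ∷ _) ℕ.zero    e e′ = ∼-trans e (∼-sym e′)
At-unique (_ ∷ ρ) (ℕ.suc k) a a′ = At-unique ρ k a a′

Prefix⇒At : ∀ π → Prefix _∼_ (π ∷ʳ y) ρ → At ρ (length π) y
Prefix⇒At []      (e ∷ _) = e
Prefix⇒At (_ ∷ π) (_ ∷ p) = Prefix⇒At π p

Legal-Prefix-option : ∀ π → x ∼ x′ → Prefix _∼_ (π ∷ʳ y) ρ → Legal s x′ ρ →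
                      y ∈[ turn s π ] end x π
Legal-Prefix-option []      e (e′ ∷ _) (o ∷ _) = ∈-resp-∼ (∼-sym e) (∼-sym e′) o
Legal-Prefix-option (_ ∷ π) _ (e ∷ p)  (_ ∷ l) = Legal-Prefix-option π e p l

applyUpTo-Prefix : ∀ σ n → Pointwise _∼_ π (applyUpTo σ n) →
                   ∃ λ y → Prefix _∼_ (π ∷ʳ y) (applyUpTo σ (ℕ.suc n))
applyUpTo-Prefix σ ℕ.zero    []       = σ 0 , ∼-refl ∷ []
applyUpTo-Prefix σ (ℕ.suc n) (e ∷ es) = map₂ (e ∷_) (applyUpTo-Prefix (σ ∘ ℕ.suc) n es)

Pointwise⇒≼ : Pointwise _∼_ π ρ → fin ρ ≼ fin π
Pointwise⇒≼ es _ p =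
  Prefix.trans ∼-trans p (Prefix.fromPointwise (Pointwise.symmetric ∼-sym es))

-- A play at whose end the next player has no option is maximal.

stuck-maximal : ¬ (∃ λ y → y ∈[ turn s π ] end x π) →
                ∀ ρ → IsPlay s x ρ → fin π ≼ ρ → ρ ≼ fin π
stuck-maximal {π = π} ¬o (fin ρ) (fin l) π≼ρ with Prefix-cases (π≼ρ π Prefix-∼-refl)
... | inj₁ es      = Pointwise⇒≼ es
... | inj₂ (y , p) = ⊥-elim (¬o (y , Legal-Prefix-option π ∼-refl p l))
stuck-maximal {π = π} ¬o (inf σ) (inf l) π≼ρ =
  let (n , es) = π≼ρ π Prefix-∼-refl
      (y , p)  = applyUpTo-Prefix σ n es
  in ⊥-elim (¬o (y , Legal-Prefix-option π ∼-refl p (l (ℕ.suc n))))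

------------------------------------------------------------------------
-- Finite plays coherent with strategies

-- Coherence of a finite sequence, in a form inherited by prefixes: every item at
-- a turn of the strategy is the move that the strategy makes there, if any.

Follows : Strategy P x → List Hypergame → Set₁
Follows {P} {x} f ρ = ∀ {π y y′} (p : FPlay P x π) → Prefix _∼_ (π ∷ʳ y) ρ →
                      move f π p ≡ just y′ → y′ ∼ y

module _ (f : Strategy P x) where

  Coherent⇒Follows : Coherent f (fin ρ) → Follows f ρ
  Coherent⇒Follows {ρ} c {π} {y} {y′} p π∷y⊑ρ m =
    At-unique ρ (length π) (Prefix⇒At π π∷y′⊑ρ) (Prefix⇒At π π∷y⊑ρ)
    where
    π∷y′⊑ρ : Prefix _∼_ (π ∷ʳ y′) ρ
    π∷y′⊑ρ = c π p (Prefix-∷ʳ⇒Prefix π π∷y⊑ρ , λ ρ≼π → ¬Prefix-∷ʳ π (ρ≼π _ π∷y⊑ρ)) y′ m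

  Follows⇒Coherent : Follows f ρ → Coherent f (fin ρ)
  Follows⇒Coherent c π p (π⊑ρ , π≠ρ) y m with Prefix-cases π⊑ρ
  ... | inj₁ es = ⊥-elim (π≠ρ (Pointwise⇒≼ es))
  ... | inj₂ (z , π∷z⊑ρ) = Prefix.trans ∼-trans
    (Prefix.++⁺ Pointwise-∼-refl (c p π∷z⊑ρ m ∷ [])) π∷z⊑ρ

  Follows-[] : Follows f []
  Follows-[] {[]}    p () m
  Follows-[] {_ ∷ _} p () m

  Follows-∷ʳ⁻ : Follows f (ρ ∷ʳ y) → Follows f ρ
  Follows-∷ʳ⁻ c p π∷y⊑ρ = c p (π∷y⊑ρ ++ᵖ _)

  Follows-∷ʳ-own : Follows f ρ → (p : FPlay P x ρ) → move f ρ p ≡ just y → Follows f (ρ ∷ʳ y)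
  Follows-∷ʳ-own {ρ} c p m {π} p₀ q m₀ with Prefix-∷ʳ-cases π ρ q
  ... | inj₁ q′       = c p₀ q′ m₀
  ... | inj₂ (es , e) with move f π p₀ | move f ρ p | m₀ | m | cong f p₀ p es
  ...   | _ | _ | refl | refl | Maybe.just e′ = ∼-trans e′ (∼-sym e)

  Follows-∷ʳ-other : Follows f ρ → ¬ turn (starter P) ρ ≡ side P → Follows f (ρ ∷ʳ y)
  Follows-∷ʳ-other {ρ} c t {π} p₀ q m₀ with Prefix-∷ʳ-cases π ρ q
  ... | inj₁ q′       = c p₀ q′ m₀
  ... | inj₂ (es , _) = ⊥-elim (t (≡.trans (≡.sym (turn-resp es)) (proj₂ p₀)))

-- A finite product f * f′ ends where the next player has no option, since otherwise
-- totality of that player's strategy would prolong it.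

IsProduct⇒stuck : {f : Strategy P x} {f′ : Strategy (opponent P) x} →
  IsProduct f f′ (fin π) → ¬ (∃ λ y → y ∈[ turn (starter P) π ] end x π)
IsProduct⇒stuck {P} {x} {π} {f} {f′} prod (y , o) with IsProduct.isPlay prod
... | fin l = [ own , theirs ]′ (same-or-opp (side P) (turn (starter P) π))
  where
  open IsProduct prod

  prolong : ∀ y → Legal (starter P) x (π ∷ʳ y) → Follows f (π ∷ʳ y) → Follows f′ (π ∷ʳ y) → ⊥
  prolong y l c c′ = ¬Prefix-∷ʳ π
    (maximal _ (fin l) (Follows⇒Coherent f c) (Follows⇒Coherent f′ c′) (λ _ q → q ++ᵖ _)
      (π ∷ʳ y) Prefix-∼-refl)

  own : turn (starter P) π ≡ side P → ⊥
  own t = prolong y₁ (legal f p m)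
    (Follows-∷ʳ-own f (Coherent⇒Follows f coherent) p m)
    (Follows-∷ʳ-other f′ (Coherent⇒Follows f′ coherent′) λ t′ → ≢-opp (side P)
      (≡.trans (≡.sym t) (≡.trans
        (≡.cong (λ s → turn s π) (≡.sym (starter-opponent P)))
        (≡.trans t′ (side-opponent P)))))
    where
    p : FPlay P x π
    p = l , t
    y₁ = proj₁ (total f p (Legal-∷ʳ⁺ l o))
    m  = proj₂ (total f p (Legal-∷ʳ⁺ l o))

  theirs : turn (starter P) π ≡ opp (side P) → ⊥
  theirs t = prolong y₁ (subst (λ s → Legal s x (π ∷ʳ y₁)) eq (legal f′ p m))
    (Follows-∷ʳ-other f (Coherent⇒Follows f coherent) λ t′ → ≢-opp (side P) (≡.trans (≡.sym t′) t))
    (Follows-∷ʳ-own f′ (Coherent⇒Follows f′ coherent′) p m)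
    where
    eq : starter (opponent P) ≡ starter P
    eq = starter-opponent P
    p : FPlay (opponent P) x π
    p = subst (λ s → Legal s x π) (≡.sym eq) l ,
        ≡.trans (≡.cong (λ s → turn s π) eq) (≡.trans t (≡.sym (side-opponent P)))
    T  = total f′ p (subst (λ s → Legal s x (π ∷ʳ y)) (≡.sym eq) (Legal-∷ʳ⁺ l o))
    y₁ = proj₁ T
    m  = proj₂ T

------------------------------------------------------------------------
-- Strategies that prefer certain moves

module _ (em : ExcludedMiddle (suc 0ℓ)) (ac : AxiomOfChoice) where

  module _ (x : Hypergame) where

    -- The axiom of choice selects one node in each bisimilarity class.  Bisimilarity
    -- lives in Set₁; passing through a Boolean makes it a relation in Set.

    private
      _~_ : Rel (Node x) 0ℓ
      m ~ n = True (em {x ↾ m ∼ x ↾ n})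

      representatives = ac (Node x) _~_ record
        { refl  = fromWitness ∼-refl
        ; sym   = λ e → fromWitness (∼-sym (toWitness e))
        ; trans = λ e e′ → fromWitness (∼-trans (toWitness e) (toWitness e′))
        }

    -- The chosen hypergame bisimilar to a position.  Bisimilar positions give
    -- identical, not just bisimilar, hypergames.

    canonical : Node x → Hypergame
    canonical n = x ↾ proj₁ representatives n

    canonical-∼ : ∀ n → canonical n ∼ x ↾ n
    canonical-∼ n = toWitness (proj₁ (proj₂ representatives) n)

    canonical-≡ : ∀ {m n} → x ↾ m ∼ x ↾ n → canonical m ≡ canonical n
    canonical-≡ e = ≡.cong (x ↾_) (proj₂ (proj₂ representatives) (fromWitness e))

  -- The end of a play is bisimilar to a position.

  end-node : ∀ {m} → y ∼ x ↾ m → Legal s y π → ∃ λ n → end y π ∼ x ↾ n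
  end-node         e []      = _ , e
  end-node {x = x} e (o ∷ l) =
    let (_ , _ , e′) = ∈-resp-∼ e ∼-refl o in end-node {x = x} e′ l

  -- An option satisfying G if there is one, otherwise any option.  Excluded middle
  -- decides a type and so returns a definite witness, the same one whenever s, w
  -- and G are the same.

  choose : Player → Hypergame → (Hypergame → Set₁) → Maybe Hypergame
  choose s w G with em {∃ λ y → y ∈[ s ] w × G y} | em {∃ λ y → y ∈[ s ] w}
  ... | yes (y , _) | _           = just y
  ... | no _        | yes (y , _) = just y
  ... | no _        | no _        = nothing

  choose-option : ∀ s w G → choose s w G ≡ just y → y ∈[ s ] w
  choose-option s w G m with em {∃ λ y → y ∈[ s ] w × G y} | em {∃ λ y → y ∈[ s ] w}
  choose-option s w G refl | yes (_ , o , _) | _           = o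
  choose-option s w G refl | no _            | yes (_ , o) = o
  choose-option s w G ()   | no _            | no _

  choose-total : ∀ s w G → y ∈[ s ] w → ∃ λ y′ → choose s w G ≡ just y′
  choose-total s w G o with em {∃ λ y → y ∈[ s ] w × G y} | em {∃ λ y → y ∈[ s ] w}
  ... | yes _ | _     = _ , refl
  ... | no _  | yes _ = _ , refl
  ... | no _  | no ¬o = ⊥-elim (¬o (_ , o))

  choose-good : ∀ s w G → y ∈[ s ] w → G y → choose s w G ≡ just y′ → G y′
  choose-good s w G o gy m with em {∃ λ y → y ∈[ s ] w × G y} | em {∃ λ y → y ∈[ s ] w}
  choose-good s w G o gy refl | yes (_ , _ , gy′) | _ = gy′
  choose-good s w G o gy m    | no ¬g             | _ = ⊥-elim (¬g (_ , o , gy))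

  -- The strategy choosing, at the canonical form of the position after a play π, a
  -- move satisfying G (length π) if there is one.  The move depends on π only through
  -- this form and the length, so that bisimilar plays get the same move.

  module _ (P : Seat) (x : Hypergame) (G : ℕ → Hypergame → Set₁) where

    private
      place : FPlay P x π → Hypergame
      place (l , _) = canonical x (proj₁ (end-node {x = x} ∼-refl l))

      place-∼ : (p : FPlay P x π) → place p ∼ end x π
      place-∼ (l , _) = let (n , e) = end-node {x = x} ∼-refl l in ∼-trans (canonical-∼ x n) (∼-sym e)

      place-≡ : (p : FPlay P x π) (p′ : FPlay P x π′) → Pointwise _∼_ π π′ → place p ≡ place p′
      place-≡ (l , _) (l′ , _) es = canonical-≡ x
        (∼-trans (∼-sym (proj₂ (end-node {x = x} ∼-refl l)))
          (∼-trans (end-resp-∼ ∼-refl es) (proj₂ (end-node {x = x} ∼-refl l′))))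

      place-option : (p : FPlay P x π) → y ∈[ turn (starter P) π ] end x π → y ∈[ side P ] place p
      place-option {π} {y} p@(_ , t) o = subst (λ s → y ∈[ s ] place p) t
        (∈-resp-∼ {K = turn (starter P) π} (∼-sym (place-∼ p)) ∼-refl o)

    prefer : Strategy P x
    prefer = record
      { move  = λ π p → choose (side P) (place p) (G (length π))
      ; cong  = λ p p′ es → Maybe.reflexive (λ { refl → ∼-refl })
                  (≡.cong₂ (λ w k → choose (side P) w (G k))
                    (place-≡ p p′ es) (Pointwise.Pointwise-length es))
      ; legal = λ {π} p@(l , t) {y} m → Legal-∷ʳ⁺ l
                  (∈-resp-∼ (place-∼ p) ∼-refl
                    (subst (λ s → y ∈[ s ] place p) (≡.sym t) (choose-option _ _ _ m)))
      ; total = λ {π} p l → choose-total _ _ _ (place-option p (proj₂ (Legal-∷ʳ⁻ π l)))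
      }

    prefer-good : (p : FPlay P x π) → y ∈[ turn (starter P) π ] end x π → G (length π) y →
                  move prefer π p ≡ just y′ → G (length π) y′
    prefer-good p o = choose-good _ _ _ (place-option p o)

------------------------------------------------------------------------
-- Determinacy

  private
    dne : {A : Set₁} → ¬ ¬ A → A
    dne = decidable-stable em

  ¬Doomed-I⇒move : ¬ Doomed (K , I) x → ∃ λ y → y ∈[ K ] x × ¬ Doomed (K , II) y
  ¬Doomed-I⇒move nd = dne λ ¬e → nd (stuck λ y o → dne λ nd′ → ¬e (y , o , nd′))

  module _ (K : Player) (o : Order) (x : Hypergame) where

    private
      P₀ : Seat
      P₀ = K , o

      turn-I : ∀ π → after o π ≡ I → turn (starter P₀) π ≡ K
      turn-I π eq = ≡.trans (turn-after K o π) (≡.cong (λ o → starter (K , o)) eq)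

      turn-II : ∀ π → after o π ≡ II → turn (starter P₀) π ≡ opp K
      turn-II π eq = ≡.trans (turn-after K o π) (≡.cong (λ o → starter (K , o)) eq)

    -- The strategy that moves, where possible, to positions where K is not doomed.

    careful : Strategy P₀ x
    careful = prefer P₀ x λ _ y → ¬ Doomed (K , II) y

    careful-¬Doomed : ¬ Doomed P₀ x → Reverse π → Legal (starter P₀) x π → Follows careful π →
                      ¬ Doomed (K , after o π) (end x π)
    careful-¬Doomed nd []           l c = nd
    careful-¬Doomed nd (π ∶ r ∶ʳ y) l c =
      subst (λ o → ¬ Doomed (K , o) (end x (π ∷ʳ y))) (≡.sym (after-∷ʳ o π y))
        (subst (λ w → ¬ Doomed (K , flip (after o π)) w) (≡.sym (end-∷ʳ x π y))
          (keep (after o π) refl))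
      where
      l′ : Legal (starter P₀) x π
      l′ = proj₁ (Legal-∷ʳ⁻ π l)

      option : y ∈[ turn (starter P₀) π ] end x π
      option = proj₂ (Legal-∷ʳ⁻ π l)

      nd′ : ¬ Doomed (K , after o π) (end x π)
      nd′ = careful-¬Doomed nd r l′ (Follows-∷ʳ⁻ careful c)

      keep : ∀ o′ → after o π ≡ o′ → ¬ Doomed (K , flip o′) y
      keep I eq d =
        let p             = l′ , turn-I π eq
            (y₁ , o₁ , h) = ¬Doomed-I⇒move (subst (λ o → ¬ Doomed (K , o) (end x π)) eq nd′)
            (y₂ , m)      = total careful p l
        in prefer-good P₀ x _ p
             (subst (λ s → y₁ ∈[ s ] end x π) (≡.sym (turn-I π eq)) o₁) h m
             (Doomed-resp-∼ (∼-sym (c p Prefix-∼-refl m)) d)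
      keep II eq d = subst (λ o → ¬ Doomed (K , o) (end x π)) eq nd′
        (beaten y (subst (λ s → y ∈[ s ] end x π) (turn-II π eq) option) d)

    careful-NonLosing : ¬ Doomed P₀ x → NonLosing careful
    careful-NonLosing nd f′ (inf σ) prod = draw
    careful-NonLosing nd f′ (fin π) prod with IsProduct.isPlay prod
    ... | fin l = win (verdict (after o π) refl)
      where
      no-option : ∀ {s} → turn (starter P₀) π ≡ s → ∀ y → ¬ y ∈[ s ] end x π
      no-option refl y m = IsProduct⇒stuck prod (y , m)

      verdict : ∀ o′ → after o π ≡ o′ → Winning K (starter P₀) x π
      verdict II eq = turn-II π eq , no-option (turn-II π eq)
      verdict I  eq = ⊥-elim
        (careful-¬Doomed nd (reverseView π) l (Coherent⇒Follows careful (IsProduct.coherent prod))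
          (subst (λ o → Doomed (K , o) (end x π)) (≡.sym eq)
            (stuck λ y m → ⊥-elim (no-option (turn-I π eq) y m))))

    -- A play coherent with f that ends with K to move and without an option.

    Lost : Strategy P₀ x → List Hypergame → Set₁
    Lost f π = Legal (starter P₀) x π × Follows f π × turn (starter P₀) π ≡ K ×
               ¬ (∃ λ y → y ∈[ turn (starter P₀) π ] end x π)

    -- From a position where K is doomed, play the moves of f for K and the moves of
    -- the derivation of doom for its opponent.

    defeat : (f : Strategy P₀ x) → ∀ {w o′} → Doomed (K , o′) w →
             ∀ π → Legal (starter P₀) x π → Follows f π → end x π ≡ w → after o π ≡ o′ →
             ∃ (Lost f)
    defeat f {w} (stuck h) π l c refl eq with move f π (l , turn-I π eq) in m
    ... | nothing = π , l , c , turn-I π eq , λ (y , o₁) →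
      absurd (≡.trans (≡.sym m) (proj₂ (total f (l , turn-I π eq) (Legal-∷ʳ⁺ l o₁))))
      where
      absurd : ∀ {y : Hypergame} → ¬ nothing ≡ just y
      absurd ()
    ... | just y = defeat f
      (h y (subst (λ s → y ∈[ s ] end x π) (turn-I π eq) (proj₂ (Legal-∷ʳ⁻ π l′))))
      (π ∷ʳ y) l′ (Follows-∷ʳ-own f c (l , turn-I π eq) m) (end-∷ʳ x π y)
      (≡.trans (after-∷ʳ o π y) (≡.cong flip eq))
      where
      l′ : Legal (starter P₀) x (π ∷ʳ y)
      l′ = legal f (l , turn-I π eq) m
    defeat f (beaten y o₁ d) π l c refl eq = defeat f d (π ∷ʳ y)
      (Legal-∷ʳ⁺ l (subst (λ s → y ∈[ s ] end x π) (≡.sym (turn-II π eq)) o₁))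
      (Follows-∷ʳ-other f c λ t → ≢-opp K (≡.trans (≡.sym t) (turn-II π eq)))
      (end-∷ʳ x π y) (≡.trans (after-∷ʳ o π y) (≡.cong flip eq))

    Doomed⇒¬NonLosing : Doomed P₀ x → (f : Strategy P₀ x) → ¬ NonLosing f
    Doomed⇒¬NonLosing d f nl = contradict (defeat f d [] [] (Follows-[] f) refl refl)
      where
      -- Against f, the strategy that follows a play lost by f has this play as product.
      contradict : ¬ ∃ (Lost f)
      contradict (π , l , c , t , ¬o) with nl f′ (fin π) record
        { isPlay    = fin l
        ; coherent  = Follows⇒Coherent f c
        ; coherent′ = Follows⇒Coherent f′ c′
        ; maximal   = λ ρ p _ _ → stuck-maximal ¬o ρ p
        }
        where
        f′ : Strategy (opponent P₀) x
        f′ = prefer (opponent P₀) x (At π)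

        option : ∀ {π₀ y} → Prefix _∼_ (π₀ ∷ʳ y) π →
                 y ∈[ turn (starter (opponent P₀)) π₀ ] end x π₀
        option {π₀} q = Legal-Prefix-option π₀ ∼-refl q
          (subst (λ s → Legal s x π) (≡.sym (starter-opponent P₀)) l)

        c′ : Follows f′ π
        c′ {π₀} p q m = At-unique π (length π₀)
          (prefer-good (opponent P₀) x (At π) p (option q) (Prefix⇒At π₀ q) m) (Prefix⇒At π₀ q)
      ... | win (t′ , _) = ≢-opp K (≡.trans (≡.sym t) t′)

  NonLosing⇔¬Doomed : ∀ P x → (∃ λ (f : Strategy P x) → NonLosing f) ⇔ (¬ Doomed P x)
  NonLosing⇔¬Doomed (K , o) x = mk⇔
    (λ (f , nl) d → Doomed⇒¬NonLosing K o x d f nl)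
    (λ nd → careful K o x , careful-NonLosing K o x nd)

  HasNonLosing⇔¬Doomed : ∀ A x → HasNonLosing A x ⇔
    (¬ Doomed (proj₁ (seats A)) x × ¬ Doomed (proj₂ (seats A)) x)
  HasNonLosing⇔¬Doomed A x = mk⇔
    (λ (f₁ , f₂ , nl₁ , nl₂) → to P₁⇔ (f₁ , nl₁) , to P₂⇔ (f₂ , nl₂))
    (λ (nd₁ , nd₂) → let (f₁ , nl₁) = from P₁⇔ nd₁ ; (f₂ , nl₂) = from P₂⇔ nd₂
                     in f₁ , f₂ , nl₁ , nl₂)
    where
    open Equivalence
    P₁⇔ = NonLosing⇔¬Doomed (proj₁ (seats A)) x
    P₂⇔ = NonLosing⇔¬Doomed (proj₂ (seats A)) x

------------------------------------------------------------------------
-- Contextual equivalence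

  Doomed-plug : ∀ C x y → x ≋ y → Doomed P (C [ ⌜ x ⌝ ]) → Doomed P (C [ ⌜ y ⌝ ])
  Doomed-plug C x y q d =
    Doomed-resp-∼ (∼-sym (plug-∼ C ⌜ y ⌝)) (Doomed-≋ em x y q (plug-∼ C ⌜ x ⌝) d)

  HasNonLosing-plug : ∀ C A x y → x ≋ y → HasNonLosing A (C [ ⌜ x ⌝ ]) →
                      HasNonLosing A (C [ ⌜ y ⌝ ])
  HasNonLosing-plug C A x y q h =
    let (nd₁ , nd₂) = Equivalence.to (HasNonLosing⇔¬Doomed A _) h
    in Equivalence.from (HasNonLosing⇔¬Doomed A _)
         (nd₁ ∘ Doomed-plug C y x (≋-sym x y q) , nd₂ ∘ Doomed-plug C y x (≋-sym x y q))

  ≋⇒≈ : ∀ x y → x ≋ y → ⌜ x ⌝ ≈ ⌜ y ⌝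
  ≋⇒≈ x y q C A = mk⇔ (HasNonLosing-plug C A x y q) (HasNonLosing-plug C A y x (≋-sym x y q))

  ≈⇒≋ : ∀ x y → ⌜ x ⌝ ≈ ⌜ y ⌝ → x ≋ y
  ≈⇒≋ x y x≈y = decidable-stable em₀ λ q →
    proj₁ (Equivalence.to (HasNonLosing⇔¬Doomed (order II) _) II-on-x+y)
      (≋̸⇒Doomed-II em x y q)
    where
    em₀ : ExcludedMiddle 0ℓ
    em₀ = lower-em em

    y≋y : y ≋ y
    y≋y = ≐-refl (∣ g y ∣)

    II-on-y+y : HasNonLosing (order II) (⌜ y ⌝ + ⌜ y ⌝)
    II-on-y+y = Equivalence.from (HasNonLosing⇔¬Doomed (order II) _)
      (≋⇒¬Doomed-II em y y y≋y ∼-refl , ≋⇒¬Doomed-II em y y y≋y ∼-refl)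

    II-on-x+y : HasNonLosing (order II) (⌜ x ⌝ + ⌜ y ⌝)
    II-on-x+y = Equivalence.from (x≈y (hole +ʳ ⌜ y ⌝) (order II)) II-on-y+y

theorem5p9 : ExcludedMiddle (suc 0ℓ) → AxiomOfChoice →
    ∀ (x y : 𝓘) → (g x ≐ᵒ g y) ⇔ (⌜ x ⌝ ≈ ⌜ y ⌝)
theorem5p9 em ac x y = mk⇔ (≋⇒≈ em ac x y) (≈⇒≋ em ac x y)
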